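{- For all positive integers $n$ and $k$ with $n \geq 2k \geq 4$, $$\chi_s(\mathrm{KG}(n,k)) \geq \max\{2\chi(\mathrm{KG}(n,k)) - 10,\ \chi(\mathrm{KG}(n,k))\}.$$
   Context: For $n \geq 2k$, the Kneser graph $\mathrm{KG}(n,k)$ is the graph whose vertices are the $k$-element subsets of $[n]=\{1,\ldots,n\}$, two vertices $A,B$ being adjacent iff $A\cap B=\emptyset$; its chromatic number is $\chi(\mathrm{KG}(n,k)) = n-2k+2$. A star-free coloring of a graph $G$ is a proper coloring $c: V(G)\to\mathbb{N}$ such that no path on three vertices is colored with just two consecutive integers. The star-free chromatic number $\chi_s(G)$ is the minimum positive integer $t$ such that there is a star-free coloring $c: V(G)\to\{1,\ldots,t\}$. -}

module Defs where

open import Data.Nat using (ℕ; suc; _+_; _*_; _∸_; _≤_; _⊔_)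
open import Data.Fin.Subset using (Subset; ∣_∣; _∩_; Empty)
open import Data.Product using (Σ; _×_; proj₁)
open import Data.Sum using (_⊎_)
open import Relation.Binary.PropositionalEquality using (_≡_; _≢_)
open import Relation.Nullary using (¬_)

KVertex : ℕ → ℕ → Set
KVertex n k = Σ (Subset n) (λ A → ∣ A ∣ ≡ k)

KAdj : ∀ {n k} → KVertex n k → KVertex n k → Set
KAdj A B = Empty (proj₁ A ∩ proj₁ B)

IsP3 : ∀ {n k} → KVertex n k → KVertex n k → KVertex n k → Set
IsP3 u v w = (u ≢ v) × (v ≢ w) × (u ≢ w) × KAdj u v × KAdj v w

Proper : ∀ {n k} → (KVertex n k → ℕ) → Set
Proper {n} {k} c = ∀ (A B : KVertex n k) → KAdj A B → c A ≢ c B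

InPair : ℕ → ℕ → Set
InPair i x = (x ≡ i) ⊎ (x ≡ suc i)

StarFree : ∀ {n k} → (KVertex n k → ℕ) → Set
StarFree {n} {k} c =
  Proper c ×
  (∀ (u v w : KVertex n k) (i : ℕ) → IsP3 u v w →
     ¬ (InPair i (c u) × InPair i (c v) × InPair i (c w)))

ColorsIn : ∀ {n k} → ℕ → (KVertex n k → ℕ) → Set
ColorsIn {n} {k} t c = ∀ (A : KVertex n k) → (1 ≤ c A) × (c A ≤ t)

-- χ(KG(n,k)) = n - 2k + 2 (Lovász), as given in the context.
χKG : ℕ → ℕ → ℕ
χKG n k = n + 2 ∸ 2 * k

{-# OPTIONS --safe #-}
module Submission where

-- Both bounds come from Tucker's lemma on the sign vectors X of length n, a
-- sign vector being a pair of disjoint subsets (its two sides).  A class of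
-- k-subsets is one-sided in X if it has members inside exactly one side.
-- Sign vectors of size at most s are labelled by their size, the others by s
-- plus their largest one-sided class, so that n ≤ s + number of classes.
--
-- For the bound χ the classes are the colours, s = 2k − 2, and a class is never
-- two-sided.  For the other bound the classes are the pairs of colours
-- {2i, 2i + 1} and s = 2k.  By star-freeness the edges inside a class form a
-- matching, so a class meeting both sides of X has exactly one member in each.
-- If no class is one-sided, X is labelled by its smallest class p, with the
-- sign of the side having the odd colour.  A smaller sign vector with label ∓p
-- would have p as its only one-sided class, so the numbers of k-subsets of its
-- two sides would differ by exactly 1; for k ≥ 2 this is impossible.

open import Defs
open import Data.Bool using (Bool; true; false; not; _xor_; _∧_)
open import Data.Bool.Properties using (not-involutive; ¬-not; xor-comm; xor-same)
import Data.Bool.Properties as Bool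
open import Data.Bool.Solver using (module xor-∧-Solver)
open import Data.Empty using (⊥; ⊥-elim)
open import Data.Fin.Subset using (Subset; ∣_∣; _∩_; Empty; _∈_; _⊆_; inside; outside)
open import Data.Fin.Subset.Properties
open import Data.List using (List; []; _∷_; _++_; map; length)
open import Data.List.Properties using (map-∘; length-map; length-++)
import Data.List.Membership.Propositional as List
open import Data.List.Membership.Propositional.Properties
  using (∈-map⁻; ∈-map⁺; ∈-++⁺ˡ; ∈-++⁺ʳ; ∈-++⁻; ∈-∃++)
open import Data.List.Relation.Unary.All as All using (All; []; _∷_)
import Data.List.Relation.Unary.All.Properties as All
open import Data.List.Relation.Unary.AllPairs as AllPairs using (AllPairs; []; _∷_)
import Data.List.Relation.Unary.AllPairs.Properties as AllPairs
open import Data.List.Relation.Unary.Any using (here; there)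
open import Data.List.Relation.Unary.Unique.Propositional using (Unique)
import Data.List.Relation.Unary.Unique.Propositional.Properties as Unique
open import Data.Maybe as Maybe using (Maybe; just; nothing)
open import Data.Nat using (ℕ; zero; suc; _+_; _*_; _∸_; _⊔_; _≤_; _<_; z≤n; s≤s;
  pred; >-nonZero; _≟_; _≡ᵇ_; _≤?_; _<?_)
open import Data.Nat.Combinatorics using (_C_; nCn≡1; nCk+nC[k+1]≡[n+1]C[k+1])
open import Data.Nat.DivMod using (_/_; _%_; m≡m%n+[m/n]*n; m%n<n; /-monoˡ-≤; m/n*n≤m)
open import Data.Nat.Properties hiding (_≟_)
open import Data.Product using (∃; ∃₂; _×_; _,_; proj₁; proj₂)
open import Data.Sum using (_⊎_; inj₁; inj₂; [_,_]′)
open import Data.Vec as Vec using (Vec; []; _∷_; here; there; replicate)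
import Data.Vec.Properties as Vec
open import Function using (_∘_)
open import Relation.Binary.PropositionalEquality
open import Relation.Nullary using (Dec; ¬_; yes; no; contradiction; ¬?; map′; _×-dec_; _⊎-dec_)
open import Relation.Unary using (Decidable)

-- Sign vectors and their order.

SignVector : ℕ → Set
SignVector = Vec (Maybe Bool)

agrees : Bool → Maybe Bool → Bool
agrees b     nothing  = false
agrees true  (just c) = c
agrees false (just c) = not c

side : ∀ {n} → Bool → SignVector n → Subset n
side b = Vec.map (agrees b)

neg : ∀ {n} → SignVector n → SignVector n
neg = Vec.map (Maybe.map not)

infix 4 _≼_

-- A record rather than a bare function type, so that `X` and `Y` can be inferred: unification
-- cannot recover a vector from its image under `Vec.map`.
record _≼_ {n} (X Y : SignVector n) : Set where
  constructor sidewise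
  field sides : ∀ b → side b X ⊆ side b Y

open _≼_

∥_∥ : ∀ {n} → SignVector n → ℕ
∥ X ∥ = ∣ side true X ∣ + ∣ side false X ∣

Nonzero : ∀ {n} → SignVector n → Set
Nonzero X = 0 < ∥ X ∥

≼-trans : ∀ {n} {X Y Z : SignVector n} → X ≼ Y → Y ≼ Z → X ≼ Z
≼-trans p q = sidewise λ b x∈ → sides q b (sides p b x∈)

side-neg : ∀ {n} b (X : SignVector n) → side b (neg X) ≡ side (not b) X
side-neg b X = trans (sym (Vec.map-∘ _ _ X)) (Vec.map-cong (agrees-not b) X)
  where
  agrees-not : ∀ b m → agrees b (Maybe.map not m) ≡ agrees (not b) m
  agrees-not true  nothing  = refl
  agrees-not false nothing  = refl
  agrees-not true  (just c) = refl
  agrees-not false (just c) = not-involutive c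

neg-zero : ∀ n → neg (replicate n nothing) ≡ replicate n nothing
neg-zero = Vec.map-replicate _ nothing

∷-mono : ∀ {n} m {X Y : SignVector n} → X ≼ Y → m ∷ X ≼ m ∷ Y
∷-mono m X≼Y = sidewise λ b → s⊆s (sides X≼Y b)

nothing∷-mono : ∀ {n} {m} {X Y : SignVector n} → X ≼ Y → nothing ∷ X ≼ m ∷ Y
nothing∷-mono X≼Y = sidewise λ b → out⊆ (sides X≼Y b)

just∷-nonzero : ∀ {n} b (X : SignVector n) → Nonzero (just b ∷ X)
just∷-nonzero true  X = s≤s z≤n
just∷-nonzero false X = ≤-trans (s≤s z≤n) (m≤n+m _ ∣ side true X ∣)

zero-≼ : ∀ {n} (X : SignVector n) → replicate n nothing ≼ X
zero-≼ (m ∷ X) = nothing∷-mono (zero-≼ X)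
zero-≼ []      = sidewise λ b ()

Chain : ∀ {n} → List (SignVector n) → Set
Chain τ = AllPairs _≼_ τ × All Nonzero τ

-- The mod 2 cycle of all maximal chains of sign vectors.

-- Mod 2 simplicial chains are represented by the functionals they induce on
-- cochains List A → Bool.

δ : {A : Set} → (List A → Bool) → List A → Bool
δ g []       = false
δ g (x ∷ xs) = g xs xor δ (g ∘ (x ∷_)) xs

δ-cong : ∀ {A : Set} {g h : List A → Bool} → (∀ xs → g xs ≡ h xs) → ∀ xs → δ g xs ≡ δ h xs
δ-cong g≗h []       = refl
δ-cong g≗h (x ∷ xs) = cong₂ _xor_ (g≗h xs) (δ-cong (λ ys → g≗h (x ∷ ys)) xs)

interchange : ∀ a b c d → (a xor b) xor (c xor d) ≡ (a xor c) xor (b xor d)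
interchange = solve 4 (λ a b c d → (a :+ b) :+ (c :+ d) := (a :+ c) :+ (b :+ d)) refl
  where open xor-∧-Solver

δ-xor : ∀ {A : Set} (g h : List A → Bool) xs →
  δ (λ ys → g ys xor h ys) xs ≡ δ g xs xor δ h xs
δ-xor g h []       = refl
δ-xor g h (x ∷ xs) =
  trans (cong ((g xs xor h xs) xor_) (δ-xor (g ∘ (x ∷_)) (h ∘ (x ∷_)) xs))
        (interchange (g xs) (h xs) _ _)

δ-map : ∀ {A B : Set} (φ : A → B) (g : List B → Bool) xs → δ g (map φ xs) ≡ δ (g ∘ map φ) xs
δ-map φ g []       = refl
δ-map φ g (x ∷ xs) = cong (g (map φ xs) xor_) (δ-map φ (g ∘ (φ x ∷_)) xs)

-- The prism over the chain Z ≼ Y₁ ≼ Y₂ ≼ …: the sum of g over the chains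
-- 0Y₁, …, 0Yᵢ, bYᵢ, bYᵢ₊₁, …, where Y₀ = Z.
mutual
  prism : ∀ {n} → Bool → SignVector n → (List (SignVector (suc n)) → Bool) →
    List (SignVector n) → Bool
  prism b Z g τ = g (map (just b ∷_) (Z ∷ τ)) xor prismTail b g τ

  prismTail : ∀ {n} → Bool → (List (SignVector (suc n)) → Bool) →
    List (SignVector n) → Bool
  prismTail b g []      = false
  prismTail b g (Y ∷ τ) = prism b Y (g ∘ ((nothing ∷ Y) ∷_)) τ

-- The sum of g over all maximal chains of nonzero sign vectors.
total : ∀ n → (List (SignVector n) → Bool) → Bool
total zero    g = g []
total (suc n) g = total n (λ τ → prism true (replicate n nothing) g τ xor
                                 prism false (replicate n nothing) g τ)

prism-cong : ∀ {n} b (Z : SignVector n) {g h} → (∀ τ → g τ ≡ h τ) →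
  ∀ τ → prism b Z g τ ≡ prism b Z h τ
prism-cong b Z g≗h []      = cong (_xor false) (g≗h _)
prism-cong b Z g≗h (Y ∷ τ) = cong₂ _xor_ (g≗h _) (prism-cong b Y (λ σ → g≗h _) τ)

prism-xor : ∀ {n} b (Z : SignVector n) g h τ →
  prism b Z (λ σ → g σ xor h σ) τ ≡ prism b Z g τ xor prism b Z h τ
prism-xor b Z g h [] = interchange (g _) (h _) false false
prism-xor b Z g h (Y ∷ τ) =
  trans (cong ((g bZ xor h bZ) xor_) (prism-xor b Y (g ∘ (_ ∷_)) (h ∘ (_ ∷_)) τ))
        (interchange (g bZ) (h bZ) _ _)
  where bZ = map (just b ∷_) (Z ∷ Y ∷ τ)

total-cong : ∀ n {g h} → (∀ τ → g τ ≡ h τ) → total n g ≡ total n h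
total-cong zero    g≗h = g≗h []
total-cong (suc n) g≗h = total-cong n λ τ →
  cong₂ _xor_ (prism-cong true _ g≗h τ) (prism-cong false _ g≗h τ)

total-xor : ∀ n g h → total n (λ τ → g τ xor h τ) ≡ total n g xor total n h
total-xor zero    g h = refl
total-xor (suc n) g h = trans
  (total-cong n λ τ → trans
    (cong₂ _xor_ (prism-xor true _ g h τ) (prism-xor false _ g h τ))
    (interchange (prism true _ g τ) (prism true _ h τ) _ _))
  (total-xor n _ _)

-- Dropping 0Yᵢ from the i-th chain of the prism leaves the same list as dropping bYᵢ₋₁ from the
-- chain before it, so these faces cancel. Dropping the last vector of the last chain leaves the
-- bottom `map (nothing ∷_) τ`, and all other faces form the prisms over the faces of `τ`.
prism-δ : ∀ {n} b (Z : SignVector n) g τ →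
  prism b Z (δ g) τ ≡ g (map (nothing ∷_) τ) xor δ (prism b Z g) τ
prism-δ b Z g [] = solve 1 (λ x → (x :+ con false) :+ con false := x :+ con false) refl (g [])
  where open xor-∧-Solver
prism-δ b Z g (Y ∷ τ) = begin
  (g bY xor (g bZ xor d)) xor prism b Y (λ σ → g σ xor δ g′ σ) τ
    ≡⟨ cong ((g bY xor (g bZ xor d)) xor_) (prism-xor b Y g (δ g′) τ) ⟩
  (g bY xor (g bZ xor d)) xor ((g bY xor t) xor prism b Y (δ g′) τ)
    ≡⟨ cong (λ e → (g bY xor (g bZ xor d)) xor ((g bY xor t) xor e)) (prism-δ b Y g′ τ) ⟩
  (g bY xor (g bZ xor d)) xor ((g bY xor t) xor (z xor e))
    -- The two copies of `g bY` cancel: one comes from dropping `just b ∷ Z`, the other from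
    -- dropping `nothing ∷ Y`.
    ≡⟨ solve 6 (λ y z′ d t z e → (y :+ (z′ :+ d)) :+ ((y :+ t) :+ (z :+ e)) :=
                 z :+ ((z′ :+ t) :+ (d :+ e))) refl (g bY) (g bZ) d t z e ⟩
  z xor ((g bZ xor t) xor (d xor e))
    ≡⟨ cong (λ u → z xor ((g bZ xor t) xor (u xor e))) (δ-map (just b ∷_) _ τ) ⟩
  z xor ((g bZ xor t) xor (δ _ τ xor e))
    ≡⟨ cong (λ u → z xor ((g bZ xor t) xor u)) (δ-xor _ _ τ) ⟨
  z xor δ (prism b Z g) (Y ∷ τ) ∎
  where
  open ≡-Reasoning
  open xor-∧-Solver
  g′ = g ∘ ((nothing ∷ Y) ∷_)
  bY = map (just b ∷_) (Y ∷ τ)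
  bZ = map (just b ∷_) (Z ∷ τ)
  d = δ (λ σ → g ((just b ∷ Z) ∷ (just b ∷ Y) ∷ σ)) (map (just b ∷_) τ)
  t = prismTail b g τ
  z = g (map (nothing ∷_) (Y ∷ τ))
  e = δ (prism b Y g′) τ

-- The maximal chains triangulate the boundary of the cross-polytope, a sphere, so their sum is a
-- cycle. Inductively, the positive and the negative prism share their bottom, which cancels mod 2,
-- and what remains is a coboundary one dimension lower.
total-δ : ∀ n g → total n (δ g) ≡ false
total-δ zero    g = refl
total-δ (suc n) g = trans (total-cong n boundary) (total-δ n _)
  where
  O = replicate n nothing
  boundary : ∀ τ → prism true O (δ g) τ xor prism false O (δ g) τ ≡
    δ (λ σ → prism true O g σ xor prism false O g σ) τ
  boundary τ = begin
    prism true O (δ g) τ xor prism false O (δ g) τ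
      ≡⟨ cong₂ _xor_ (prism-δ true O g τ) (prism-δ false O g τ) ⟩
    (z xor δ (prism true O g) τ) xor (z xor δ (prism false O g) τ)
      ≡⟨ interchange z _ z _ ⟩
    (z xor z) xor (δ (prism true O g) τ xor δ (prism false O g) τ)
      ≡⟨ cong (_xor (δ (prism true O g) τ xor δ (prism false O g) τ)) (xor-same z) ⟩
    δ (prism true O g) τ xor δ (prism false O g) τ
      ≡⟨ δ-xor (prism true O g) (prism false O g) τ ⟨
    δ (λ σ → prism true O g σ xor prism false O g σ) τ ∎
    where
    open ≡-Reasoning
    z = g (map (nothing ∷_) τ)

prism-neg : ∀ {n} b (Z : SignVector n) g τ →
  prism b Z (g ∘ map neg) τ ≡ prism (not b) (neg Z) g (map neg τ)
prism-neg b Z g τ = cong₂ _xor_ (cong (g ∘ ((just (not b) ∷ neg Z) ∷_)) (head τ)) (tail τ)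
  where
  head : ∀ τ → map neg (map (just b ∷_) τ) ≡ map (just (not b) ∷_) (map neg τ)
  head τ = trans (sym (map-∘ τ)) (map-∘ τ)
  tail : ∀ τ → prismTail b (g ∘ map neg) τ ≡ prismTail (not b) g (map neg τ)
  tail []      = refl
  tail (Y ∷ τ) = prism-neg b Y (g ∘ ((nothing ∷ neg Y) ∷_)) τ

prism-neg-zero : ∀ n b g τ → prism b (replicate n nothing) (g ∘ map neg) τ ≡
  prism (not b) (replicate n nothing) g (map neg τ)
prism-neg-zero n b g τ = trans (prism-neg b (replicate n nothing) g τ)
  (cong (λ Z → prism (not b) Z g (map neg τ)) (neg-zero n))

-- The antipodal map permutes the maximal chains, exchanging the positive and the negative prisms.
total-neg : ∀ n g → total n (g ∘ map neg) ≡ total n g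
total-neg zero    g = refl
total-neg (suc n) g = trans
  (total-cong n λ τ → trans
    (cong₂ _xor_ (prism-neg-zero n true g τ) (prism-neg-zero n false g τ))
    (xor-comm (prism false _ g (map neg τ)) _))
  (total-neg n _)

xor-true : ∀ a b → a xor b ≡ true → a ≡ true ⊎ b ≡ true
xor-true true  b e = inj₁ refl
xor-true false b e = inj₂ e

map-chain : ∀ {n} b {τ : List (SignVector n)} → AllPairs _≼_ τ → Chain (map (just b ∷_) τ)
map-chain b {τ} pairs =
  AllPairs.map⁺ (AllPairs.map (∷-mono (just b)) pairs) ,
  All.map⁺ (All.universal (just∷-nonzero b) τ)

-- A mod 2 sum equal to `true` has a summand equal to `true`. The lower bound `nothing ∷ Z` on the
-- chain is carried along so that the recursion may put a vector in front of it.
prism-witness : ∀ {n} b (Z : SignVector n) g τ →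
  AllPairs _≼_ (Z ∷ τ) → All Nonzero τ → prism b Z g τ ≡ true →
  ∃ λ σ → Chain σ × All (nothing ∷ Z ≼_) σ × length σ ≡ suc (length τ) × g σ ≡ true
prism-witness b Z g τ pairs nz e with xor-true (g _) _ e
... | inj₁ e₁ = _ , map-chain b pairs ,
  All.map⁺ (All.map nothing∷-mono (sidewise (λ _ x → x) ∷ AllPairs.head pairs)) ,
  length-map _ (Z ∷ τ) , e₁
prism-witness b Z g (Y ∷ τ) ((Z≼Y ∷ _) ∷ pairs) (nzY ∷ nz) e | inj₂ e₂
  with prism-witness b Y _ τ pairs nz e₂
... | σ , (pairsσ , nzσ) , Y≼σ , len , e′ =
  _ , (Y≼σ ∷ pairsσ , nzY ∷ nzσ) ,
  nothing∷-mono Z≼Y ∷ All.map (≼-trans (nothing∷-mono Z≼Y)) Y≼σ ,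
  cong suc len , e′

total-witness : ∀ n g → total n g ≡ true →
  ∃ λ τ → Chain τ × length τ ≡ n × g τ ≡ true
total-witness zero    g e = [] , ([] , []) , refl , e
total-witness (suc n) g e with total-witness n _ e
... | τ , (pairs , nz) , len , e′ with xor-true (prism true _ g τ) _ e′
...   | inj₁ e₁ =
  let σ , chain , _ , lenσ , eσ = prism-witness true _ g τ (All.universal zero-≼ τ ∷ pairs) nz e₁
  in σ , chain , trans lenσ (cong suc len) , eσ
...   | inj₂ e₂ =
  let σ , chain , _ , lenσ , eσ = prism-witness false _ g τ (All.universal zero-≼ τ ∷ pairs) nz e₂
  in σ , chain , trans lenσ (cong suc len) , eσ

xor-false⇒≡ : ∀ a b → (a xor b ≡ true → a ≡ b) → a ≡ b
xor-false⇒≡ true  true  f = refl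
xor-false⇒≡ true  false f = f refl
xor-false⇒≡ false true  f = f refl
xor-false⇒≡ false false f = refl

≡⇒¬xor : ∀ {a b} → a ≡ b → a xor b ≢ true
≡⇒¬xor {a} refl e with trans (sym (xor-same a)) e
... | ()

-- If the two sums differed, the sum of `g xor h` would be `true`, and its witness would be a chain
-- on which `g` and `h` differ.
prism-cong-chain : ∀ {n} b (Z : SignVector n) {g h} → (∀ σ → Chain σ → g σ ≡ h σ) →
  ∀ τ → AllPairs _≼_ (Z ∷ τ) → All Nonzero τ → prism b Z g τ ≡ prism b Z h τ
prism-cong-chain b Z {g} {h} g≗h τ pairs nz = xor-false⇒≡ _ _ λ e →
  let σ , chain , _ , _ , eσ =
        prism-witness b Z (λ σ → g σ xor h σ) τ pairs nz (trans (prism-xor b Z g h τ) e)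
  in contradiction eσ (≡⇒¬xor (g≗h σ chain))

total-cong-chain : ∀ n {g h} → (∀ τ → Chain τ → g τ ≡ h τ) → total n g ≡ total n h
total-cong-chain n {g} {h} g≗h = xor-false⇒≡ _ _ λ e →
  let σ , chain , _ , eσ = total-witness n _ (trans (total-xor n g h) e)
  in contradiction eσ (≡⇒¬xor (g≗h σ chain))

-- Signed labels and sorting by absolute value.

-- A sign, `true` for plus, with an absolute value. Absolute values start at 0, and +0 and -0 are
-- different labels.
Label : Set
Label = Bool × ℕ

flip : Label → Label
flip (b , i) = not b , i

insert : Label → List Label → List Label
insert x [] = x ∷ []
insert x (y ∷ ys) with proj₂ x ≤? proj₂ y
... | yes _ = x ∷ y ∷ ys
... | no  _ = y ∷ insert x ys

sort : List Label → List Label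
sort []       = []
sort (x ∷ xs) = insert x (sort xs)

_⊑_ : Label → Label → Set
x ⊑ y = proj₂ x ≤ proj₂ y

Sorted : List Label → Set
Sorted = AllPairs _⊑_

insert-All : ∀ {P : Label → Set} {x} ys → P x → All P ys → All P (insert x ys)
insert-All [] px _ = px ∷ []
insert-All {x = x} (y ∷ ys) px (py ∷ pys) with proj₂ x ≤? proj₂ y
... | yes _ = px ∷ py ∷ pys
... | no  _ = py ∷ insert-All ys px pys

sort-All : ∀ {P : Label → Set} {xs} → All P xs → All P (sort xs)
sort-All [] = []
sort-All (px ∷ pxs) = insert-All _ px (sort-All pxs)

insert-sorted : ∀ x ys → Sorted ys → Sorted (insert x ys)
insert-sorted x [] _ = [] ∷ []
insert-sorted x (y ∷ ys) (y⊑ ∷ sorted) with proj₂ x ≤? proj₂ y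
... | yes x⊑y = (x⊑y ∷ All.map (≤-trans x⊑y) y⊑) ∷ y⊑ ∷ sorted
... | no  x⋢y = insert-All ys (<⇒≤ (≰⇒> x⋢y)) y⊑ ∷ insert-sorted x ys sorted

sort-sorted : ∀ xs → Sorted (sort xs)
sort-sorted []       = []
sort-sorted (x ∷ xs) = insert-sorted x (sort xs) (sort-sorted xs)

length-insert : ∀ x ys → length (insert x ys) ≡ suc (length ys)
length-insert x [] = refl
length-insert x (y ∷ ys) with proj₂ x ≤? proj₂ y
... | yes _ = refl
... | no  _ = cong suc (length-insert x ys)

length-sort : ∀ xs → length (sort xs) ≡ length xs
length-sort []       = refl
length-sort (x ∷ xs) = trans (length-insert x (sort xs)) (cong suc (length-sort xs))

insert-least : ∀ x ys → All (x ⊑_) ys → insert x ys ≡ x ∷ ys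
insert-least x [] _ = refl
insert-least x (y ∷ ys) (x⊑y ∷ _) with proj₂ x ≤? proj₂ y
... | yes _   = refl
... | no  x⋢y = contradiction x⊑y x⋢y

-- Only absolute values are compared, so changing all signs moves nothing.
insert-flip : ∀ x ys → insert (flip x) (map flip ys) ≡ map flip (insert x ys)
insert-flip x [] = refl
insert-flip x (y ∷ ys) with proj₂ x ≤? proj₂ y
... | yes _ = refl
... | no  _ = cong (flip y ∷_) (insert-flip x ys)

sort-flip : ∀ xs → sort (map flip xs) ≡ map flip (sort xs)
sort-flip []       = refl
sort-flip (x ∷ xs) = trans (cong (insert (flip x)) (sort-flip xs)) (insert-flip x (sort xs))

δ-cong-least : ∀ x (g h : List Label → Bool) → (∀ ys → All (x ⊑_) ys → g ys ≡ h ys) →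
  ∀ ys → All (x ⊑_) ys → δ g ys ≡ δ h ys
δ-cong-least x g h e []       _          = refl
δ-cong-least x g h e (y ∷ ys) (py ∷ pys) = cong₂ _xor_ (e ys pys)
  (δ-cong-least x _ _ (λ zs pzs → e (y ∷ zs) (py ∷ pzs)) ys pys)

insert-greater : ∀ {x y} ys → ¬ (x ⊑ y) → insert x (y ∷ ys) ≡ y ∷ insert x ys
insert-greater {x} {y} ys x⋢y with proj₂ x ≤? proj₂ y
... | yes x⊑y = contradiction x⊑y x⋢y
... | no  _   = refl

-- Deleting an entry of `insert x ys` removes either `x`, which leaves `ys`, or an entry of `ys`,
-- and then `x` can as well be inserted afterwards. Mod 2 the position of the deleted entry
-- contributes no sign.
δ-insert : ∀ g x ys → Sorted ys → g ys xor δ (g ∘ insert x) ys ≡ δ g (insert x ys)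
δ-insert g x [] _ = refl
δ-insert g x (y ∷ ys) (y⊑ ∷ sorted) = by-cases (proj₂ x ≤? proj₂ y)
  where
  open ≡-Reasoning
  open xor-∧-Solver
  by-cases : Dec (x ⊑ y) →
    g (y ∷ ys) xor δ (g ∘ insert x) (y ∷ ys) ≡ δ g (insert x (y ∷ ys))
  by-cases (yes x⊑y) = begin
    g (y ∷ ys) xor δ (g ∘ insert x) (y ∷ ys)
      ≡⟨ cong (g (y ∷ ys) xor_) (δ-cong-least x (g ∘ insert x) (g ∘ (x ∷_))
           (λ zs least → cong g (insert-least x zs least)) (y ∷ ys) x⊑) ⟩
    δ g (x ∷ y ∷ ys)
      ≡⟨ cong (δ g) (insert-least x (y ∷ ys) x⊑) ⟨
    δ g (insert x (y ∷ ys)) ∎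
    where x⊑ = x⊑y ∷ All.map (≤-trans x⊑y) y⊑
  by-cases (no x⋢y) = begin
    g (y ∷ ys) xor (g (insert x ys) xor δ (g ∘ insert x ∘ (y ∷_)) ys)
      ≡⟨ cong (λ e → g (y ∷ ys) xor (g (insert x ys) xor e))
           (δ-cong (λ zs → cong g (insert-greater zs x⋢y)) ys) ⟩
    g (y ∷ ys) xor (g (insert x ys) xor δ (g ∘ (y ∷_) ∘ insert x) ys)
      ≡⟨ solve 3 (λ a b c → a :+ (b :+ c) := b :+ (a :+ c)) refl
           (g (y ∷ ys)) (g (insert x ys)) _ ⟩
    g (insert x ys) xor (g (y ∷ ys) xor δ (g ∘ (y ∷_) ∘ insert x) ys)
      ≡⟨ cong (g (insert x ys) xor_) (δ-insert (g ∘ (y ∷_)) x ys sorted) ⟩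
    δ g (y ∷ insert x ys)
      ≡⟨ cong (δ g) (insert-greater ys x⋢y) ⟨
    δ g (insert x (y ∷ ys)) ∎

δ-sort : ∀ g xs → δ (g ∘ sort) xs ≡ δ g (sort xs)
δ-sort g []       = refl
δ-sort g (x ∷ xs) = trans (cong (g (sort xs) xor_) (δ-sort (g ∘ insert x) xs))
                          (δ-insert g x (sort xs) (sort-sorted xs))

-- Alternating sequences of signs.

alternating : Bool → List Bool → Bool
alternating b []       = true
alternating b (c ∷ cs) = not (b xor c) ∧ alternating (not b) cs

alternating-not : ∀ b cs → alternating b (map not cs) ≡ alternating (not b) cs
alternating-not b []       = refl
alternating-not b (c ∷ cs) = cong₂ _∧_
  (cong not (trans (sym (Bool.not-distribʳ-xor b c)) (Bool.not-distribˡ-xor b c)))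
  (alternating-not (not b) cs)

δ-false : ∀ {A : Set} (xs : List A) → δ (λ _ → false) xs ≡ false
δ-false []       = refl
δ-false (x ∷ xs) = δ-false xs

-- If a nonempty `cs` alternates, exactly one deletion leaves a sequence alternating from `b`: that
-- of the last entry if `cs` starts with `b`, of the first otherwise. If `cs` does not alternate,
-- such a deletion removes one of two equal neighbours, and removing the other does the same, so the
-- count is even.
δ-alternating : ∀ b cs → δ (alternating b) cs ≡ alternating true cs xor alternating false cs
δ-alternating b [] = refl
δ-alternating true (true ∷ cs) = trans (cong (alternating true cs xor_) (δ-alternating false cs))
  (solve 2 (λ a b → a :+ (a :+ b) := b :+ con false) refl
    (alternating true cs) (alternating false cs))
  where open xor-∧-Solver
δ-alternating true (false ∷ cs) =
  trans (cong (alternating true cs xor_) (δ-false cs)) (Bool.xor-identityʳ _)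
δ-alternating false (true ∷ cs) = cong (alternating false cs xor_) (δ-false cs)
δ-alternating false (false ∷ cs) =
  trans (cong (alternating false cs xor_) (δ-alternating true cs))
  (solve 2 (λ a b → b :+ (a :+ b) := a) refl (alternating true cs) (alternating false cs))
  where open xor-∧-Solver

-- Fan's lemma and Tucker's lemma.

Antipodal : ∀ {n} → (SignVector n → Label) → Set
Antipodal lab = ∀ X → Nonzero X → lab (neg X) ≡ flip (lab X)

signs : List Label → List Bool
signs = map proj₁ ∘ sort

alternatingLabels : ∀ {n} → (SignVector n → Label) → Bool → List (SignVector n) → Bool
alternatingLabels lab b = alternating b ∘ signs ∘ map lab

-- Taking faces commutes with labelling, sorting and forgetting absolute values, so the count for
-- sign sequences carries over to chains.
δ-alternatingLabels : ∀ {n} (lab : SignVector n → Label) b τ → δ (alternatingLabels lab b) τ ≡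
  alternatingLabels lab true τ xor alternatingLabels lab false τ
δ-alternatingLabels lab b τ = begin
  δ (alternatingLabels lab b) τ                  ≡⟨ δ-map lab _ τ ⟨
  δ (alternating b ∘ signs) (map lab τ)          ≡⟨ δ-sort _ (map lab τ) ⟩
  δ (alternating b ∘ map proj₁) (sort (map lab τ)) ≡⟨ δ-map proj₁ _ (sort (map lab τ)) ⟨
  δ (alternating b) (signs (map lab τ))          ≡⟨ δ-alternating b (signs (map lab τ)) ⟩
  alternatingLabels lab true τ xor alternatingLabels lab false τ ∎
  where open ≡-Reasoning

alternatingLabels-neg : ∀ {n} {lab : SignVector n → Label} → Antipodal lab → ∀ b τ → Chain τ →
  alternatingLabels lab b (map neg τ) ≡ alternatingLabels lab (not b) τ
alternatingLabels-neg {lab = lab} anti b τ (_ , nz) =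
  trans (cong (alternating b) lemma) (alternating-not b (signs (map lab τ)))
  where
  open ≡-Reasoning
  labels : ∀ {τ} → All Nonzero τ → map lab (map neg τ) ≡ map flip (map lab τ)
  labels []         = refl
  labels (nzX ∷ nz) = cong₂ _∷_ (anti _ nzX) (labels nz)
  lemma : signs (map lab (map neg τ)) ≡ map not (signs (map lab τ))
  lemma = begin
    signs (map lab (map neg τ))              ≡⟨ cong signs (labels nz) ⟩
    map proj₁ (sort (map flip (map lab τ)))  ≡⟨ cong (map proj₁) (sort-flip (map lab τ)) ⟩
    map proj₁ (map flip (sort (map lab τ)))  ≡⟨ map-∘ _ ⟨
    map (not ∘ proj₁) (sort (map lab τ))     ≡⟨ map-∘ _ ⟩
    map not (signs (map lab τ))              ∎

-- Fan's lemma: the number of maximal chains with alternating labels, the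
-- smallest label being positive, is odd.  By antipodality the negative prisms
-- contribute the chains of the positive prisms whose smallest label is negative,
-- and the sum of the two cochains is the coboundary of either of them.
fan : ∀ n (lab : SignVector n → Label) → Antipodal lab →
  total n (alternatingLabels lab true) ≡ true
fan zero    lab anti = refl
fan (suc n) lab anti = begin
  total n (λ τ → prism true O a⁺ τ xor prism false O a⁺ τ)
    ≡⟨ total-xor n (prism true O a⁺) (prism false O a⁺) ⟩
  total n (prism true O a⁺) xor total n (prism false O a⁺)
    ≡⟨ cong (total n (prism true O a⁺) xor_) (total-neg n (prism false O a⁺)) ⟨
  total n (prism true O a⁺) xor total n (prism false O a⁺ ∘ map neg)
    ≡⟨ cong (total n (prism true O a⁺) xor_) (total-cong n (prism-neg-zero n true a⁺)) ⟨
  total n (prism true O a⁺) xor total n (prism true O (a⁺ ∘ map neg))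
    ≡⟨ cong (total n (prism true O a⁺) xor_) (total-cong-chain n λ τ (pairs , nz) →
         prism-cong-chain true O (alternatingLabels-neg anti true) τ
           (All.universal zero-≼ τ ∷ pairs) nz) ⟩
  total n (prism true O a⁺) xor total n (prism true O a⁻)
    ≡⟨ total-xor n (prism true O a⁺) (prism true O a⁻) ⟨
  total n (λ τ → prism true O a⁺ τ xor prism true O a⁻ τ)
    ≡⟨ total-cong n (λ τ → trans (sym (prism-xor true O a⁺ a⁻ τ))
         (trans (prism-cong true O (λ σ → sym (δ-alternatingLabels lab true σ)) τ)
                (prism-δ true O a⁺ τ))) ⟩
  total n (λ τ → a⁺ (map (nothing ∷_) τ) xor δ (prism true O a⁺) τ)
    ≡⟨ total-xor n (a⁺ ∘ map (nothing ∷_)) (δ (prism true O a⁺)) ⟩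
  total n (a⁺ ∘ map (nothing ∷_)) xor total n (δ (prism true O a⁺))
    ≡⟨ cong₂ _xor_
         (total-cong n (λ τ → cong (alternating true ∘ signs) (sym (map-∘ τ))))
         (total-δ n (prism true O a⁺)) ⟩
  total n (alternatingLabels (lab ∘ (nothing ∷_)) true) xor false
    ≡⟨ cong (_xor false) (fan n (lab ∘ (nothing ∷_)) (λ X → anti (nothing ∷ X))) ⟩
  true ∎
  where
  open ≡-Reasoning
  O = replicate n nothing
  a⁺ = alternatingLabels lab true
  a⁻ = alternatingLabels lab false

NoComplementary : List Label → Set
NoComplementary xs = ∀ {x y} → x List.∈ xs → y List.∈ xs → proj₂ x ≡ proj₂ y → proj₁ x ≡ proj₁ y

-- Neighbours have opposite signs, hence different absolute values when no two labels are
-- complementary. The absolute values therefore increase strictly, starting at that of `x` and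
-- staying below `m`.
length-alternating : ∀ m b x xs → Sorted (x ∷ xs) → NoComplementary (x ∷ xs) →
  All (λ y → proj₂ y < m) (x ∷ xs) → alternating b (map proj₁ (x ∷ xs)) ≡ true →
  length xs + proj₂ x < m
length-alternating m b x [] _ _ (x<m ∷ _) _ = x<m
length-alternating m b x (y ∷ ys) ((x⊑y ∷ _) ∷ sorted) compl (_ ∷ bounds) alt =
  ≤-<-trans (≤-trans (≤-reflexive (sym (+-suc (length ys) (proj₂ x))))
                     (+-monoʳ-≤ (length ys) x<y))
    (length-alternating m (not b) y ys sorted (λ p q → compl (there p) (there q)) bounds
      (tail b (proj₁ x) alt))
  where
  tail : ∀ b c {d} → not (b xor c) ∧ d ≡ true → d ≡ true
  tail true  true  e = e
  tail false false e = e
  signs-differ : ∀ b c d {e} →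
    not (b xor c) ∧ (not (not b xor d) ∧ e) ≡ true → c ≢ d
  signs-differ true  true  true  () refl
  signs-differ false false false () refl
  x<y : proj₂ x < proj₂ y
  x<y = ≤∧≢⇒< x⊑y λ e →
    signs-differ b (proj₁ x) (proj₁ y) alt (compl (here refl) (there (here refl)) e)

AllPairs-∈ : ∀ {A : Set} {R : A → A → Set} {xs : List A} → AllPairs R xs →
  ∀ {x y} → x List.∈ xs → y List.∈ xs → x ≡ y ⊎ (R x y ⊎ R y x)
AllPairs-∈ (_ ∷ _)  (here refl) (here refl) = inj₁ refl
AllPairs-∈ (r ∷ _)  (here refl) (there q)   = inj₂ (inj₁ (All.lookup r q))
AllPairs-∈ (r ∷ _)  (there p)   (here refl) = inj₂ (inj₂ (All.lookup r p))
AllPairs-∈ (_ ∷ rs) (there p)   (there q)   = AllPairs-∈ rs p q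

-- An odd number of alternating maximal chains means that there is one. It has `n` vectors, and
-- their labels have distinct absolute values below `m`.
tucker : ∀ n m (lab : SignVector n → Label) → Antipodal lab →
  (∀ X → Nonzero X → proj₂ (lab X) < m) →
  (∀ X Y → Nonzero X → X ≼ Y → proj₂ (lab X) ≡ proj₂ (lab Y) → proj₁ (lab X) ≡ proj₁ (lab Y)) →
  n ≤ m
tucker n m lab anti bound compl
  with total-witness n _ (fan n lab anti)
... | τ , (pairs , nz) , len , alt =
  subst (_≤ m) (trans (length-sort (map lab τ)) (trans (length-map lab τ) len))
    (conclude (sort (map lab τ)) (sort-sorted (map lab τ)) noCompl
      (sort-All (All.map⁺ (All.map (bound _) nz))) alt)
  where
  ∈-sort : ∀ {x} → x List.∈ sort (map lab τ) → ∃ λ X → X List.∈ τ × x ≡ lab X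
  ∈-sort p = ∈-map⁻ lab (All.lookup (sort-All (All.tabulate (λ q → q))) p)
  noCompl : NoComplementary (sort (map lab τ))
  noCompl p q e with ∈-sort p | ∈-sort q
  ... | X , X∈ , refl | Y , Y∈ , refl with AllPairs-∈ pairs X∈ Y∈
  ...   | inj₁ refl       = refl
  ...   | inj₂ (inj₁ X≼Y) = compl X Y (All.lookup nz X∈) X≼Y e
  ...   | inj₂ (inj₂ Y≼X) = sym (compl Y X (All.lookup nz Y∈) Y≼X (sym e))
  conclude : ∀ xs → Sorted xs → NoComplementary xs → All (λ y → proj₂ y < m) xs →
    alternating true (map proj₁ xs) ≡ true → length xs ≤ m
  conclude [] _ _ _ _ = z≤n
  conclude (x ∷ xs) s c b a =
    ≤-trans (s≤s (m≤m+n (length xs) (proj₂ x))) (length-alternating m true x xs s c b a)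

-- Sizes of sign vectors, and Tucker's lemma for labels given by a relation.

∥just∷∥ : ∀ {n} b (X : SignVector n) → ∥ just b ∷ X ∥ ≡ suc ∥ X ∥
∥just∷∥ true  X = refl
∥just∷∥ false X = +-suc ∣ side true X ∣ ∣ side false X ∣

∥neg∥ : ∀ {n} (X : SignVector n) → ∥ neg X ∥ ≡ ∥ X ∥
∥neg∥ X = trans (cong₂ (λ p q → ∣ p ∣ + ∣ q ∣) (side-neg true X) (side-neg false X))
                (+-comm ∣ side false X ∣ ∣ side true X ∣)

∥∥-sides : ∀ {n} b (X : SignVector n) → ∣ side b X ∣ + ∣ side (not b) X ∣ ≡ ∥ X ∥
∥∥-sides true  X = refl
∥∥-sides false X = +-comm ∣ side false X ∣ ∣ side true X ∣

∥∥-mono : ∀ {n} {X Y : SignVector n} → X ≼ Y → ∥ X ∥ ≤ ∥ Y ∥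
∥∥-mono X≼Y = +-mono-≤ (p⊆q⇒∣p∣≤∣q∣ (sides X≼Y true)) (p⊆q⇒∣p∣≤∣q∣ (sides X≼Y false))

sides-disjoint : ∀ {n} b (X : SignVector n) {x} → x ∈ side b X → ¬ (x ∈ side (not b) X)
sides-disjoint true  (just true  ∷ X) here ()
sides-disjoint false (just false ∷ X) here ()
sides-disjoint b     (_ ∷ X) (there p) (there q) = sides-disjoint b X p q

∷-≼⁻ : ∀ {n l m} {X Y : SignVector n} → l ∷ X ≼ m ∷ Y → X ≼ Y
∷-≼⁻ lX≼mY = sidewise λ b → drop-∷-⊆ (sides lX≼mY b)

≼∧∥∥⇒≡ : ∀ {n} {X Y : SignVector n} → X ≼ Y → ∥ X ∥ ≡ ∥ Y ∥ → X ≡ Y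
≼∧∥∥⇒≡ {X = []} {[]} _ _ = refl
≼∧∥∥⇒≡ {X = nothing ∷ X} {nothing ∷ Y} X≼Y e = cong (nothing ∷_) (≼∧∥∥⇒≡ (∷-≼⁻ X≼Y) e)
≼∧∥∥⇒≡ {X = nothing ∷ X} {just c ∷ Y} X≼Y e =
  contradiction (∥∥-mono (∷-≼⁻ X≼Y)) (<⇒≱ (≤-reflexive (trans (sym (∥just∷∥ c Y)) (sym e))))
≼∧∥∥⇒≡ {X = just true  ∷ X} {nothing ∷ Y} X≼Y _ with () ← sides X≼Y true here
≼∧∥∥⇒≡ {X = just false ∷ X} {nothing ∷ Y} X≼Y _ with () ← sides X≼Y false here
≼∧∥∥⇒≡ {X = just true  ∷ X} {just false ∷ Y} X≼Y _ with () ← sides X≼Y true here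
≼∧∥∥⇒≡ {X = just false ∷ X} {just true  ∷ Y} X≼Y _ with () ← sides X≼Y false here
≼∧∥∥⇒≡ {X = just true  ∷ X} {just true  ∷ Y} X≼Y e =
  cong (_ ∷_) (≼∧∥∥⇒≡ (∷-≼⁻ X≼Y) (suc-injective e))
≼∧∥∥⇒≡ {X = just false ∷ X} {just false ∷ Y} X≼Y e = cong (_ ∷_) (≼∧∥∥⇒≡ (∷-≼⁻ X≼Y)
  (suc-injective (trans (sym (∥just∷∥ false X)) (trans e (∥just∷∥ false Y)))))

-- The value on the zero vector is irrelevant.
lead : ∀ {n} → SignVector n → Bool
lead []            = true
lead (nothing ∷ X) = lead X
lead (just b  ∷ X) = b

lead-neg : ∀ {n} (X : SignVector n) → Nonzero X → lead (neg X) ≡ not (lead X)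
lead-neg (nothing ∷ X) nz = lead-neg X nz
lead-neg (just b  ∷ X) _  = refl

-- A relation lets labels be described without computing the choices that produce them. Antipodality
-- survives the choice: the label of `neg X` and the flipped label of `X` both satisfy `R (neg X)`,
-- so `unique` equates their absolute values and `compatible`, applied to `neg X` below itself,
-- their signs.
tucker-relation : ∀ n m (R : SignVector n → Bool → ℕ → Set) →
  (∀ X → Nonzero X → ∃₂ (R X)) →
  (∀ {X b i} → R X b i → i < m) →
  (∀ {X b i} → Nonzero X → R X (not b) i → R (neg X) b i) →
  (∀ {X b c i j} → R X b i → R X c j → i ≡ j) →
  (∀ {X Y b c i} → X ≼ Y → R X b i → R Y c i → b ≡ c) →
  n ≤ m
tucker-relation n m R label bound antipodal unique compatible =
  tucker n m lab lab-neg lab-bound lab-compatible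
  where
  lab : SignVector n → Label
  lab X with 0 <? ∥ X ∥
  ... | yes nz = let b , i , _ = label X nz in b , i
  -- A default for the zero vector, which lies in no chain.
  ... | no  _  = true , 0

  lab-R : ∀ X → Nonzero X → R X (proj₁ (lab X)) (proj₂ (lab X))
  lab-R X nz with 0 <? ∥ X ∥
  ... | yes nz′ = proj₂ (proj₂ (label X nz′))
  ... | no  z   = contradiction nz z

  lab-bound : ∀ X → Nonzero X → proj₂ (lab X) < m
  lab-bound X nz = bound (lab-R X nz)

  lab-neg : Antipodal lab
  lab-neg X nz = cong₂ _,_ (compatible (sidewise λ _ x∈ → x∈) R₁ R₂′) (unique R₁ R₂)
    where
    R₁ = lab-R (neg X) (subst (0 <_) (sym (∥neg∥ X)) nz)
    R₂ : R (neg X) (not (proj₁ (lab X))) (proj₂ (lab X))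
    R₂ = antipodal nz (subst (λ b → R X b (proj₂ (lab X))) (sym (not-involutive _)) (lab-R X nz))
    R₂′ = subst (R (neg X) (not (proj₁ (lab X)))) (sym (unique R₁ R₂)) R₂

  lab-compatible : ∀ X Y → Nonzero X → X ≼ Y →
    proj₂ (lab X) ≡ proj₂ (lab Y) → proj₁ (lab X) ≡ proj₁ (lab Y)
  lab-compatible X Y nz X≼Y e = compatible X≼Y (lab-R X nz)
    (subst (R Y (proj₁ (lab Y))) (sym e) (lab-R Y (≤-trans nz (∥∥-mono X≼Y))))

-- Greatest and least elements of decidable sets of numbers.

greatest : ∀ {D : ℕ → Set} → Decidable D → ∀ r → (∀ {q} → D q → q < r) →
  (∃ λ p → D p × (∀ {q} → D q → q ≤ p)) ⊎ (∀ {q} → ¬ D q)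
greatest D? zero bound = inj₂ λ d → n≮0 (bound d)
greatest D? (suc r) bound with D? r
... | yes d = inj₁ (r , d , λ dq → ≤-pred (bound dq))
... | no ¬d = greatest D? r λ dq → ≤∧≢⇒< (≤-pred (bound dq)) λ { refl → ¬d dq }

least : ∀ {D : ℕ → Set} → Decidable D → ∀ {q} → D q →
  ∃ λ p → D p × (∀ {q} → D q → p ≤ q)
least {D} D? {q} dq = search q 0 (subst D (sym (+-identityʳ q)) dq) λ _ → z≤n
  where
  search : ∀ i p → D (i + p) → (∀ {q} → D q → p ≤ q) → ∃ λ p → D p × (∀ {q} → D q → p ≤ q)
  search zero    p d low = p , d , low
  search (suc i) p d low with D? p
  ... | yes dp = p , dp , low
  ... | no ¬dp = search i (suc p) (subst D (sym (+-suc i p)) d)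
    λ dq → ≤∧≢⇒< (low dq) λ { refl → ¬dp dq }

∃Bool? : ∀ {P : Bool → Set} → Decidable P → Dec (∃ P)
∃Bool? P? = map′ (λ { (inj₁ p) → true , p ; (inj₂ p) → false , p })
  (λ { (true , p) → inj₁ p ; (false , p) → inj₂ p }) (P? true ⊎-dec P? false)

-- Lists of k-subsets and binomial coefficients.

subsets : ∀ {n} → ℕ → Subset n → List (Subset n)
subsets k       (outside ∷ p) = map (outside ∷_) (subsets k p)
subsets zero    []            = [] ∷ []
subsets (suc k) []            = []
subsets zero    (inside ∷ p)  = map (outside ∷_) (subsets zero p)
subsets (suc k) (inside ∷ p)  =
  map (inside ∷_) (subsets k p) ++ map (outside ∷_) (subsets (suc k) p)

subsets-complete : ∀ {n} (A p : Subset n) → A ⊆ p → A List.∈ subsets ∣ A ∣ p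
subsets-complete [] [] _ = here refl
subsets-complete (outside ∷ A) (outside ∷ p) A⊆p =
  ∈-map⁺ _ (subsets-complete A p (drop-∷-⊆ A⊆p))
subsets-complete (inside ∷ A) (outside ∷ p) A⊆p with A⊆p here
... | ()
subsets-complete (inside ∷ A) (inside ∷ p) A⊆p =
  ∈-++⁺ˡ (∈-map⁺ _ (subsets-complete A p (drop-∷-⊆ A⊆p)))
subsets-complete (outside ∷ A) (inside ∷ p) A⊆p
  with ∣ A ∣ | subsets-complete A p (drop-∷-⊆ A⊆p)
... | zero  | A∈ = ∈-map⁺ _ A∈
... | suc k | A∈ = ∈-++⁺ʳ (map (inside ∷_) (subsets k p)) (∈-map⁺ _ A∈)

outside-⊆ : ∀ {n k x} {A p : Subset n} → A ⊆ p × ∣ A ∣ ≡ k →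
  outside ∷ A ⊆ x ∷ p × ∣ outside ∷ A ∣ ≡ k
outside-⊆ (A⊆p , e) = out⊆ A⊆p , e

inside-⊆ : ∀ {n k} {A p : Subset n} → A ⊆ p × ∣ A ∣ ≡ k →
  inside ∷ A ⊆ inside ∷ p × ∣ inside ∷ A ∣ ≡ suc k
inside-⊆ (A⊆p , e) = in⊆in A⊆p , cong suc e

subsets-sound : ∀ {n} k (p : Subset n) → All (λ A → A ⊆ p × ∣ A ∣ ≡ k) (subsets k p)
subsets-sound zero    []            = ((λ x∈ → x∈) , refl) ∷ []
subsets-sound (suc k) []            = []
subsets-sound k       (outside ∷ p) =
  All.map⁺ (All.map outside-⊆ (subsets-sound k p))
subsets-sound zero    (inside ∷ p)  =
  All.map⁺ (All.map outside-⊆ (subsets-sound zero p))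
subsets-sound (suc k) (inside ∷ p)  = All.++⁺
  (All.map⁺ (All.map inside-⊆ (subsets-sound k p)))
  (All.map⁺ (All.map outside-⊆ (subsets-sound (suc k) p)))

subsets-unique : ∀ {n} k (p : Subset n) → Unique (subsets k p)
subsets-unique zero    []            = [] ∷ []
subsets-unique (suc k) []            = []
subsets-unique k       (outside ∷ p) = Unique.map⁺ Vec.∷-injectiveʳ (subsets-unique k p)
subsets-unique zero    (inside ∷ p)  = Unique.map⁺ Vec.∷-injectiveʳ (subsets-unique zero p)
subsets-unique (suc k) (inside ∷ p)  = Unique.++⁺
  (Unique.map⁺ Vec.∷-injectiveʳ (subsets-unique k p))
  (Unique.map⁺ Vec.∷-injectiveʳ (subsets-unique (suc k) p))
  λ (A∈ , A∈′) → case-heads (∈-map⁻ _ A∈) (∈-map⁻ _ A∈′)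
  where
  case-heads : ∀ {A} → (∃ λ B → B List.∈ subsets k p × A ≡ inside ∷ B) →
    ¬ (∃ λ B → B List.∈ subsets (suc k) p × A ≡ outside ∷ B)
  case-heads (_ , _ , refl) (_ , _ , ())

length-subsets : ∀ {n} k (p : Subset n) → length (subsets k p) ≡ ∣ p ∣ C k
length-subsets zero    []            = refl
length-subsets (suc k) []            = refl
length-subsets k       (outside ∷ p) = trans (length-map _ (subsets k p)) (length-subsets k p)
length-subsets zero    (inside ∷ p)  = trans (length-map _ (subsets zero p)) (length-subsets zero p)
length-subsets (suc k) (inside ∷ p)  = begin
  length (map (inside ∷_) (subsets k p) ++ map (outside ∷_) (subsets (suc k) p))
    ≡⟨ length-++ (map (inside ∷_) (subsets k p)) ⟩
  length (map (inside ∷_) (subsets k p)) + length (map (outside ∷_) (subsets (suc k) p))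
    ≡⟨ cong₂ _+_ (trans (length-map _ (subsets k p)) (length-subsets k p))
                 (trans (length-map _ (subsets (suc k) p)) (length-subsets (suc k) p)) ⟩
  ∣ p ∣ C k + ∣ p ∣ C suc k
    ≡⟨ nCk+nC[k+1]≡[n+1]C[k+1] ∣ p ∣ k ⟩
  suc ∣ p ∣ C suc k ∎
  where open ≡-Reasoning

C-monoˡ : ∀ k {m n} → m ≤ n → m C k ≤ n C k
C-monoˡ zero    _   = ≤-refl
C-monoˡ (suc k) {n = n} z≤n = z≤n
C-monoˡ (suc k) {suc m} {suc n} (s≤s m≤n) = begin
  suc m C suc k         ≡⟨ nCk+nC[k+1]≡[n+1]C[k+1] m k ⟨
  m C k + m C suc k     ≤⟨ +-mono-≤ (C-monoˡ k m≤n) (C-monoˡ (suc k) m≤n) ⟩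
  n C k + n C suc k     ≡⟨ nCk+nC[k+1]≡[n+1]C[k+1] n k ⟩
  suc n C suc k         ∎
  where open ≤-Reasoning

0<C : ∀ {n k} → k ≤ n → 0 < n C k
0<C {n} {k} k≤n = ≤-trans (≤-reflexive (sym (nCn≡1 k))) (C-monoˡ k k≤n)

1<C : ∀ {n k} → k < n → 0 < k → 1 < n C k
1<C {suc n} {suc k} (s≤s k<n) _ = begin
  2                 ≤⟨ +-mono-≤ (0<C (<⇒≤ k<n)) (0<C k<n) ⟩
  n C k + n C suc k ≡⟨ nCk+nC[k+1]≡[n+1]C[k+1] n k ⟩
  suc n C suc k     ∎
  where open ≤-Reasoning

-- If `a ≤ b`, monotonicity decides. Otherwise Pascal's rule puts `a C k` above `b C k` by at least
-- `(a − 1) C (k − 1)`, which exceeds 1 because `0 < k − 1 < a − 1`; the second inequality follows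
-- from the bound on `a + b`.
C-gap : ∀ a b k → 2 ≤ k → 2 * k < a + b → a C k ≢ suc (b C k)
C-gap a b (suc k) (s≤s 0<k) large e with a ≤? b
... | yes a≤b = <⇒≱ (≤-reflexive (sym e)) (C-monoˡ (suc k) a≤b)
C-gap zero b (suc k) (s≤s 0<k) large e | no a≰b = a≰b z≤n
C-gap (suc a) b (suc k) (s≤s 0<k) large e | no a≰b = <⇒≱ gap (≤-reflexive e)
  where
  open ≤-Reasoning
  b≤a : b ≤ a
  b≤a = ≤-pred (≰⇒> a≰b)
  k<a : k < a
  k<a = ≰⇒> λ a≤k → <⇒≱ large (begin
    suc a + b        ≤⟨ +-mono-≤ (s≤s a≤k) (≤-trans b≤a (≤-trans a≤k (n≤1+n k))) ⟩
    suc k + suc k    ≡⟨ cong (suc k +_) (+-identityʳ (suc k)) ⟨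
    2 * suc k        ∎)
  gap : suc (b C suc k) < suc a C suc k
  gap = begin-strict
    1 + b C suc k     <⟨ +-mono-<-≤ (1<C k<a 0<k) (C-monoˡ (suc k) b≤a) ⟩
    a C k + a C suc k ≡⟨ nCk+nC[k+1]≡[n+1]C[k+1] a k ⟩
    suc a C suc k     ∎

-- Comparing lengths of lists without repetitions.

∈-remove : ∀ {A : Set} {x y : A} ys {zs} → y ≢ x → y List.∈ ys ++ x ∷ zs → y List.∈ ys ++ zs
∈-remove ys y≢x y∈ with ∈-++⁻ ys y∈
... | inj₁ y∈ys         = ∈-++⁺ˡ y∈ys
... | inj₂ (here y≡x)   = contradiction y≡x y≢x
... | inj₂ (there y∈zs) = ∈-++⁺ʳ ys y∈zs

length-⊆ : ∀ {A : Set} {xs ys : List A} → Unique xs →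
  (∀ {x} → x List.∈ xs → x List.∈ ys) → length xs ≤ length ys
length-⊆ [] _ = z≤n
length-⊆ {xs = x ∷ xs} (x∉xs ∷ unique) xs⊆ys with ∈-∃++ (xs⊆ys (here refl))
... | ys , zs , refl = begin
  suc (length xs)                ≤⟨ s≤s (length-⊆ unique λ y∈xs → ∈-remove ys
                                      (λ { refl → All.lookup x∉xs y∈xs refl })
                                      (xs⊆ys (there y∈xs))) ⟩
  suc (length (ys ++ zs))        ≡⟨ cong suc (length-++ ys) ⟩
  suc (length ys + length zs)    ≡⟨ +-suc (length ys) (length zs) ⟨
  length ys + suc (length zs)    ≡⟨ length-++ ys ⟨
  length (ys ++ x ∷ zs)          ∎
  where open ≤-Reasoning

unique-map : ∀ {A B : Set} {f : A → B} {xs} → Unique xs →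
  (∀ {x y} → x List.∈ xs → y List.∈ xs → f x ≡ f y → x ≡ y) → Unique (map f xs)
unique-map [] _ = []
unique-map (x∉xs ∷ unique) inj =
  All.map⁺ (All.tabulate λ y∈ e → All.lookup x∉xs y∈ (inj (here refl) (there y∈) e)) ∷
  unique-map unique (λ p q → inj (there p) (there q))

-- The labelling of sign vectors by classes of k-subsets.

-- Here `f` gives the class of a k-subset, `r` bounds the number of classes, and `h` marks one end
-- of every edge inside a class. The alternatives in `proper-or-large` serve the two bounds: either
-- no class contains an edge, or vectors larger than `s` are large enough for the counting argument.
module Labelling {n} (k s r : ℕ) (f : Subset n → ℕ) (h : Subset n → Bool)
  (2k≤2+s : 2 * k ≤ 2 + s)
  (f<r : ∀ A → ∣ A ∣ ≡ k → f A < r)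
  (h-differ : ∀ {A B} → ∣ A ∣ ≡ k → ∣ B ∣ ≡ k → Empty (A ∩ B) → f A ≡ f B → h A ≢ h B)
  (matching : ∀ {A A′ B} → ∣ A ∣ ≡ k → ∣ A′ ∣ ≡ k → ∣ B ∣ ≡ k → Empty (A ∩ B) → Empty (A′ ∩ B) →
    f A ≡ f B → f A′ ≡ f B → A ≡ A′)
  (proper-or-large : (∀ {A B} → ∣ A ∣ ≡ k → ∣ B ∣ ≡ k → Empty (A ∩ B) → f A ≢ f B) ⊎
    (2 ≤ k × 2 * k ≤ s))
  where

  record KSet (X : SignVector n) (b : Bool) (A : Subset n) : Set where
    constructor kset
    field
      within : A ⊆ side b X
      size   : ∣ A ∣ ≡ k
  open KSet

  Occurs : SignVector n → Bool → ℕ → Set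
  Occurs X b p = ∃ λ A → KSet X b A × f A ≡ p

  OneSided : SignVector n → Bool → ℕ → Set
  OneSided X b p = Occurs X b p × ¬ Occurs X (not b) p

  Balanced : SignVector n → Set
  Balanced X = ∀ b {p} → Occurs X b p → Occurs X (not b) p

  -- In a balanced vector the members of a class on the two sides are disjoint, so `h` differs on
  -- them and the class is marked on exactly one side. That side supplies the sign.
  Marked : SignVector n → Bool → ℕ → Set
  Marked X b p = ∃ λ A → KSet X b A × f A ≡ p × h A ≡ true

  -- Absolute values below `s` are sizes lowered by one, to start at 0; classes are shifted up by
  -- `s`.
  data Labels (X : SignVector n) (b : Bool) (i : ℕ) : Set where
    small    : suc i ≡ ∥ X ∥ → i < s → lead X ≡ b → Labels X b i
    oneSided : s < ∥ X ∥ → ∀ {p} → i ≡ s + p → OneSided X b p →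
      (∀ {c q} → OneSided X c q → q ≤ p) → Labels X b i
    balanced : s < ∥ X ∥ → ∀ {p} → i ≡ s + p → Balanced X → Marked X b p →
      (∀ {c q} → Occurs X c q → p ≤ q) → Labels X b i

  ksets-disjoint : ∀ {X b A B} → KSet X b A → KSet X (not b) B → Empty (A ∩ B)
  ksets-disjoint {X} {b} {A} {B} a a′ (x , x∈) =
    let x∈A , x∈B = x∈p∩q⁻ A B x∈ in sides-disjoint b X (within a x∈A) (within a′ x∈B)

  kset? : ∀ X b → Decidable (KSet X b)
  kset? X b A with A ⊆? side b X | ∣ A ∣ ≟ k
  ... | yes A⊆ | yes e = yes (kset A⊆ e)
  ... | no ¬A⊆ | _     = no λ a → ¬A⊆ (within a)
  ... | _      | no ¬e = no (¬e ∘ size)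

  occurs? : ∀ X b → Decidable (Occurs X b)
  occurs? X b p = anySubset? λ A → kset? X b A ×-dec (f A ≟ p)

  oneSided? : ∀ X b → Decidable (OneSided X b)
  oneSided? X b p = occurs? X b p ×-dec ¬? (occurs? X (not b) p)

  kset-mono : ∀ {X Y b A} → X ≼ Y → KSet X b A → KSet Y b A
  kset-mono X≼Y a = kset (sides X≼Y _ ∘ within a) (size a)

  occurs-mono : ∀ {X Y b p} → X ≼ Y → Occurs X b p → Occurs Y b p
  occurs-mono X≼Y (A , a , e) = A , kset-mono X≼Y a , e

  occurs-neg⁺ : ∀ {X b p} → Occurs X (not b) p → Occurs (neg X) b p
  occurs-neg⁺ {X} {b} (A , a , e) =
    A , kset (subst (A ⊆_) (sym (side-neg b X)) (within a)) (size a) , e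

  occurs-neg⁻ : ∀ {X b p} → Occurs (neg X) b p → Occurs X (not b) p
  occurs-neg⁻ {X} {b} (A , a , e) =
    A , kset (subst (A ⊆_) (side-neg b X) (within a)) (size a) , e

  labels-neg : ∀ {X b i} → Nonzero X → Labels X (not b) i → Labels (neg X) b i
  labels-neg {X} {b} nz (small e i<s l) =
    small (trans e (sym (∥neg∥ X))) i<s
      (trans (lead-neg X nz) (trans (cong not l) (not-involutive b)))
  labels-neg {X} nz (oneSided s< e (occ , ¬occ) max) =
    oneSided (subst (s <_) (sym (∥neg∥ X)) s<) e
      (occurs-neg⁺ occ , ¬occ ∘ occurs-neg⁻)
      (λ (o , ¬o) → max (occurs-neg⁻ o , ¬o ∘ occurs-neg⁺))
  labels-neg {X} {b} nz (balanced s< e bal (A , a , eA , hA) min) =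
    balanced (subst (s <_) (sym (∥neg∥ X)) s<) e
      (λ c → occurs-neg⁺ ∘ bal (not c) ∘ occurs-neg⁻)
      (A , kset (subst (A ⊆_) (sym (side-neg b X)) (within a)) (size a) , eA , hA)
      (min ∘ occurs-neg⁻)

  labels-bound : ∀ {X b i} → Labels X b i → i < s + r
  labels-bound (small _ i<s _) = ≤-trans i<s (m≤m+n s r)
  labels-bound (oneSided _ refl ((A , a , refl) , _) _) = +-monoʳ-< s (f<r A (size a))
  labels-bound (balanced _ refl _ (A , a , refl , _) _) = +-monoʳ-< s (f<r A (size a))

  balanced⇒¬oneSided : ∀ {X b p} → Balanced X → ¬ OneSided X b p
  balanced⇒¬oneSided bal (occ , ¬occ) = ¬occ (bal _ occ)

  marked⇒occurs : ∀ {X b p} → Marked X b p → Occurs X b p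
  marked⇒occurs (A , a , e , _) = A , a , e

  -- The three kinds of label exclude one another, by size and by the existence of a one-sided
  -- class. Within a kind, the size, the maximum or the minimum determines the value.
  labels-unique : ∀ {X b c i j} → Labels X b i → Labels X c j → i ≡ j
  labels-unique (small e _ _) (small e′ _ _) = suc-injective (trans e (sym e′))
  labels-unique (small e i<s _) (oneSided s< _ _ _) =
    contradiction (subst (s <_) (sym e) s<) (≤⇒≯ i<s)
  labels-unique (small e i<s _) (balanced s< _ _ _ _) =
    contradiction (subst (s <_) (sym e) s<) (≤⇒≯ i<s)
  labels-unique (oneSided s< _ _ _) (small e i<s _) =
    contradiction (subst (s <_) (sym e) s<) (≤⇒≯ i<s)
  labels-unique (oneSided _ refl o max) (oneSided _ refl o′ max′) =
    cong (s +_) (≤-antisym (max′ o) (max o′))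
  labels-unique (oneSided _ _ o _) (balanced _ _ bal _ _) =
    contradiction o (balanced⇒¬oneSided bal)
  labels-unique (balanced s< _ _ _ _) (small e i<s _) =
    contradiction (subst (s <_) (sym e) s<) (≤⇒≯ i<s)
  labels-unique (balanced _ _ bal _ _) (oneSided _ _ o _) =
    contradiction o (balanced⇒¬oneSided bal)
  labels-unique (balanced _ refl _ m min) (balanced _ refl _ m′ min′) =
    cong (s +_) (≤-antisym (min (marked⇒occurs m′)) (min′ (marked⇒occurs m)))

  kset-double : ∀ X b {A} → KSet X b A → KSet X (not (not b)) A
  kset-double X b {A} = subst (λ c → KSet X c A) (sym (not-involutive b))

  -- Balance supplies a set `B` of the same class on the opposite side. It is disjoint from both `A`
  -- and `A′`, so `matching` identifies them.
  balanced⇒injective : ∀ {Y} → Balanced Y → ∀ b {A A′} → KSet Y b A → KSet Y b A′ →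
    f A ≡ f A′ → A ≡ A′
  balanced⇒injective bal b {A} a a′ e with bal b (A , a , refl)
  ... | B , b′ , eB = matching (size a) (size a′) (size b′)
    (ksets-disjoint a b′) (ksets-disjoint a′ b′) (sym eB) (trans (sym e) (sym eB))

  classes : SignVector n → Bool → List ℕ
  classes X b = map f (subsets k (side b X))

  ∈-classes⁺ : ∀ {X b p} → Occurs X b p → p List.∈ classes X b
  ∈-classes⁺ {X} {b} (A , kset A⊆ refl , refl) = ∈-map⁺ f (subsets-complete A (side b X) A⊆)

  ∈-subsets⁻ : ∀ {X b A} → A List.∈ subsets k (side b X) → KSet X b A
  ∈-subsets⁻ {X} {b} A∈ =
    let A⊆ , e = All.lookup (subsets-sound k (side b X)) A∈ in kset A⊆ e

  ∈-classes⁻ : ∀ {X b p} → p List.∈ classes X b → Occurs X b p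
  ∈-classes⁻ p∈ with ∈-map⁻ f p∈
  ... | A , A∈ , refl = A , ∈-subsets⁻ A∈ , refl

  length-classes : ∀ X b → length (classes X b) ≡ ∣ side b X ∣ C k
  length-classes X b = trans (length-map f (subsets k (side b X))) (length-subsets k (side b X))

  -- This turns counting the classes on a side of `X` into counting its k-subsets, that is, into a
  -- binomial coefficient.
  classes-unique : ∀ {X Y} → X ≼ Y → Balanced Y → ∀ b → Unique (classes X b)
  classes-unique {X} X≼Y bal b = unique-map (subsets-unique k (side b X)) λ A∈ A′∈ →
    balanced⇒injective bal b (kset-mono X≼Y (∈-subsets⁻ A∈)) (kset-mono X≼Y (∈-subsets⁻ A′∈))

  -- The only one-sided class of X would be p, so the two sides of X would
  -- have numbers of k-subsets differing by exactly one.
  ¬oneSided-below-balanced : ∀ {X Y b p} → s < ∥ X ∥ → X ≼ Y →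
    OneSided X b p → (∀ {c q} → OneSided X c q → q ≤ p) →
    Balanced Y → (∀ {c q} → Occurs Y c q → p ≤ q) → ⊥
  ¬oneSided-below-balanced {X} {Y} {b} {p} s< X≼Y (occ@(A , a , eA) , ¬occ) max bal min =
    -- By balance `p` occurs on both sides of `Y`, which yields two disjoint k-sets in one class.
    [ (λ proper →
        let A′ , a′ , eA′ = occurs-mono X≼Y occ
            B , b′ , eB = bal b (A′ , a′ , eA′)
        in proper (size a′) (size b′) (ksets-disjoint a′ b′) (trans eA′ (sym eB)))
    , (λ (2≤k , 2k≤s) → C-gap ∣ side b X ∣ ∣ side (not b) X ∣ k 2≤k
        (≤-<-trans 2k≤s (subst (s <_) (sym (∥∥-sides b X)) s<))
        (subst₂ (λ u v → u ≡ suc v) (length-classes X b) (length-classes X (not b))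
          (≤-antisym (length-⊆ (classes-unique X≼Y bal b) ⊆₁)
                     (length-⊆ (All.tabulate (λ { q∈ refl → ¬occ (∈-classes⁻ q∈) }) ∷
                                classes-unique X≼Y bal (not b)) ⊆₂))))
    ]′ proper-or-large
    where
    -- A one-sided class of `X` is at most `p` by `max`, and at least `p` since it occurs in `Y`,
    -- where `p` is the smallest class.
    only : ∀ c {q} → Occurs X c q → q ≡ p ⊎ Occurs X (not c) q
    only c {q} o with occurs? X (not c) q
    ... | yes o′ = inj₂ o′
    ... | no ¬o′ = inj₁ (≤-antisym (max (o , ¬o′)) (min (occurs-mono X≼Y o)))
    ⊆₁ : ∀ {q} → q List.∈ classes X b → q List.∈ p ∷ classes X (not b)
    ⊆₁ q∈ with only b (∈-classes⁻ q∈)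
    ... | inj₁ q≡p = here q≡p
    ... | inj₂ o   = there (∈-classes⁺ o)
    ⊆₂ : ∀ {q} → q List.∈ p ∷ classes X (not b) → q List.∈ classes X b
    ⊆₂ (here refl) = ∈-classes⁺ occ
    ⊆₂ {q} (there q∈) with only (not b) (∈-classes⁻ q∈)
    ... | inj₁ refl = ∈-classes⁺ occ
    ... | inj₂ o    = ∈-classes⁺ (subst (λ c → Occurs X c q) (not-involutive b) o)

  -- Comparable vectors of equal size coincide, which settles two small labels. A class occurring on
  -- side `b` of `X` still does so in `Y`, so if it is one-sided there, the signs agree. If both
  -- vectors are balanced, opposite signs would give disjoint sets of one class, both marked.
  labels-compatible : ∀ {X Y b c i} → X ≼ Y → Labels X b i → Labels Y c i → b ≡ c
  labels-compatible X≼Y (small e _ refl) (small e′ _ refl) =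
    cong lead (≼∧∥∥⇒≡ X≼Y (trans (sym e) e′))
  labels-compatible X≼Y (small _ i<s _) (oneSided _ refl _ _) =
    contradiction (m≤m+n s _) (<⇒≱ i<s)
  labels-compatible X≼Y (small _ i<s _) (balanced _ refl _ _ _) =
    contradiction (m≤m+n s _) (<⇒≱ i<s)
  labels-compatible X≼Y (oneSided _ refl _ _) (small _ i<s _) =
    contradiction (m≤m+n s _) (<⇒≱ i<s)
  labels-compatible {b = b} {c} X≼Y (oneSided _ refl (occ , _) _) (oneSided _ e (_ , ¬occ) _)
    with refl ← +-cancelˡ-≡ s _ _ e with b Bool.≟ c
  ... | yes b≡c = b≡c
  ... | no  b≢c with refl ← ¬-not b≢c = contradiction (occurs-mono X≼Y occ) ¬occ
  labels-compatible X≼Y (oneSided s< refl o max) (balanced _ e bal _ min)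
    with refl ← +-cancelˡ-≡ s _ _ e =
    ⊥-elim (¬oneSided-below-balanced s< X≼Y o max bal min)
  labels-compatible X≼Y (balanced _ refl _ _ _) (small _ i<s _) =
    contradiction (m≤m+n s _) (<⇒≱ i<s)
  labels-compatible {X} {Y} {b} {c} X≼Y (balanced _ refl bal m _) (oneSided _ e (_ , ¬occ) _)
    with refl ← +-cancelˡ-≡ s _ _ e with b Bool.≟ c
  ... | yes b≡c = b≡c
  ... | no  b≢c with refl ← ¬-not b≢c =
    contradiction (occurs-mono X≼Y (marked⇒occurs m)) ¬occ
  labels-compatible {Y = Y} {b} {c} X≼Y (balanced _ refl _ (A , a , eA , hA) _)
    (balanced _ e _ (B , a′ , eB , hB) _)
    with refl ← +-cancelˡ-≡ s _ _ e with b Bool.≟ c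
  ... | yes b≡c = b≡c
  ... | no  b≢c with refl ← ¬-not b≢c = contradiction (trans hA (sym hB))
    (h-differ (size a) (size a′)
      (ksets-disjoint (kset-mono X≼Y a) (kset-double Y c a′)) (trans eA (sym eB)))

  -- With fewer than `k` elements on each side the size would be at most 2k - 2, hence at most `s`.
  large-side : ∀ (X : SignVector n) → s < ∥ X ∥ → ∃ λ b → k ≤ ∣ side b X ∣
  large-side X s< with k ≤? ∣ side true X ∣ | k ≤? ∣ side false X ∣
  ... | yes k≤ | _      = true , k≤
  ... | no _   | yes k≤ = false , k≤
  ... | no k≰  | no k≰′ = contradiction 2k≤2+s (<⇒≱ (begin-strict
    2 + s                                               <⟨ +-monoʳ-< 2 s< ⟩
    2 + (∣ side true X ∣ + ∣ side false X ∣)            ≡⟨ cong suc (+-suc _ _) ⟨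
    suc (∣ side true X ∣) + suc (∣ side false X ∣)      ≤⟨ +-mono-≤ (≰⇒> k≰) (≰⇒> k≰′) ⟩
    k + k                                               ≡⟨ cong (k +_) (+-identityʳ k) ⟨
    2 * k                                               ∎))
    where open ≤-Reasoning

  some-class : ∀ X → s < ∥ X ∥ → ∃₂ (Occurs X)
  some-class X s< with large-side X s<
  ... | b , k≤ with classes X b in eq | subst (0 <_) (sym (length-classes X b)) (0<C k≤)
  ...   | p ∷ _ | _ = b , p , ∈-classes⁻ (subst (p List.∈_) (sym eq) (here refl))

  label-balanced : ∀ X → s < ∥ X ∥ → Balanced X → ∃₂ (Labels X)
  label-balanced X s< bal with some-class X s<
  ... | b , _ , occ with least (λ p → ∃Bool? (λ b → occurs? X b p)) (b , occ)
  ...   | p , (c , A , a , eA) , min with bal c (A , a , eA) | h A in hA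
  ...     | _             | true  =
    c , s + p , balanced s< refl bal (A , a , eA , hA) (λ o → min (_ , o))
  -- The member `A` is unmarked, so its partner `B` on the other side is marked, and the sign is
  -- that of the other side.
  ...     | B , b′ , eB   | false =
    not c , s + p , balanced s< refl bal (B , b′ , eB , hB) (λ o → min (_ , o))
    where
    hB : h B ≡ true
    hB = ¬-not λ hB → h-differ (size a) (size b′) (ksets-disjoint a b′)
      (trans eA (sym eB)) (trans hA (sym hB))

  label : ∀ X → Nonzero X → ∃₂ (Labels X)
  label X nz with ∥ X ∥ ≤? s
  ... | yes ≤s = lead X , pred ∥ X ∥ , small e (subst (_≤ s) (sym e) ≤s) refl
    where e = suc-pred ∥ X ∥ ⦃ >-nonZero nz ⦄
  ... | no ≰s with greatest (λ p → ∃Bool? (λ b → oneSided? X b p)) r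
    (λ { (_ , (A , a , refl) , _) → f<r A (size a) })
  ...   | inj₁ (p , (b , o) , max) = b , s + p , oneSided (≰⇒> ≰s) refl o (λ o′ → max (_ , o′))
  ...   | inj₂ none = label-balanced X (≰⇒> ≰s) bal
    where
    bal : Balanced X
    bal b {p} o with occurs? X (not b) p
    ... | yes o′ = o′
    ... | no ¬o′ = contradiction (b , o , ¬o′) none

  bound : n ≤ s + r
  bound = tucker-relation n (s + r) Labels label labels-bound labels-neg
    labels-unique labels-compatible

-- From colourings to the two lower bounds.

-- Colouring all subsets, with 0 off the k-subsets, keeps proofs of size out of the equations
-- between colours.
extend : ∀ {n k} → (KVertex n k → ℕ) → Subset n → ℕ
extend {k = k} c A with ∣ A ∣ ≟ k
... | yes e = c (A , e)
... | no  _ = 0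

extend-≡ : ∀ {n k} (c : KVertex n k → ℕ) {A} (e : ∣ A ∣ ≡ k) → extend c A ≡ c (A , e)
extend-≡ {k = k} c {A} e with ∣ A ∣ ≟ k
... | yes e′ = cong (λ e → c (A , e)) (≡-irrelevant e′ e)
... | no ¬e  = contradiction e ¬e

odd : ℕ → Bool
odd x = x % 2 ≡ᵇ 1

%2-cases : ∀ x → x % 2 ≡ 0 ⊎ x % 2 ≡ 1
%2-cases x with x % 2 | m%n<n x 2
... | 0 | _ = inj₁ refl
... | 1 | _ = inj₂ refl
... | suc (suc _) | s≤s (s≤s ())

half-pair : ∀ {p} x → x / 2 ≡ p → InPair (p * 2) x
half-pair x refl with %2-cases x
... | inj₁ e = inj₁ (trans (m≡m%n+[m/n]*n x 2) (cong (_+ x / 2 * 2) e))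
... | inj₂ e = inj₂ (trans (m≡m%n+[m/n]*n x 2) (cong (_+ x / 2 * 2) e))

half-odd-injective : ∀ x y → x / 2 ≡ y / 2 → odd x ≡ odd y → x ≡ y
half-odd-injective x y e o = trans (m≡m%n+[m/n]*n x 2)
  (trans (cong₂ (λ u v → u + v * 2) %≡ e) (sym (m≡m%n+[m/n]*n y 2)))
  where
  odd-% : ∀ x y → odd x ≡ odd y → x % 2 ≡ y % 2
  odd-% x y o with x % 2 | %2-cases x | y % 2 | %2-cases y
  ... | _ | inj₁ refl | _ | inj₁ refl = refl
  ... | _ | inj₁ refl | _ | inj₂ refl with () ← o
  ... | _ | inj₂ refl | _ | inj₁ refl with () ← o
  ... | _ | inj₂ refl | _ | inj₂ refl = refl
  %≡ = odd-% x y o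

∩-comm-Empty : ∀ {n} {A B : Subset n} → Empty (A ∩ B) → Empty (B ∩ A)
∩-comm-Empty {A = A} {B} = subst Empty (∩-comm A B)

disjoint-distinct : ∀ {n k} {A B : Subset n} → 0 < k → ∣ A ∣ ≡ k → Empty (A ∩ B) → A ≢ B
disjoint-distinct {n} {A = A} 0<k refl disjoint refl = <⇒≢ 0<k (sym
  (trans (cong ∣_∣ (Empty-unique (subst Empty (∩-idem A) disjoint))) (∣⊥∣≡0 n)))

-- With colours as classes, properness says that no class contains two disjoint sets. So a constant
-- mark is enough, and `matching` holds vacuously.
chromatic-bound : ∀ n k t → 2 ≤ 2 * k →
  (c : KVertex n k → ℕ) → Proper c → ColorsIn t c → n + 2 ≤ 2 * k + t
chromatic-bound n k t 2≤2k c proper range = begin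
  n + 2                 ≡⟨ +-comm n 2 ⟩
  2 + n                 ≤⟨ +-monoʳ-≤ 2 (Labelling.bound k s t f (λ _ → true)
                             (≤-reflexive (sym 2+s≡2k)) f<t
                             (λ a b d e _ → distinct a b d e)
                             (λ a _ b d _ e _ → contradiction e (distinct a b d))
                             (inj₁ distinct)) ⟩
  2 + (s + t)           ≡⟨ cong (_+ t) 2+s≡2k ⟩
  2 * k + t             ∎
  where
  open ≤-Reasoning
  s = 2 * k ∸ 2
  2+s≡2k : 2 + s ≡ 2 * k
  2+s≡2k = m+[n∸m]≡n 2≤2k
  -- Colours run from 1 to `t`; lowering them by one gives exactly `t` classes, numbered from 0.
  f = pred ∘ extend c
  positive : ∀ A → ∣ A ∣ ≡ k → suc (f A) ≡ extend c A
  positive A a = suc-pred (extend c A)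
    ⦃ >-nonZero (subst (1 ≤_) (sym (extend-≡ c a)) (proj₁ (range (A , a)))) ⦄
  f<t : ∀ A → ∣ A ∣ ≡ k → f A < t
  f<t A a = subst (_≤ t) (sym (trans (positive A a) (extend-≡ c a))) (proj₂ (range (A , a)))
  distinct : ∀ {A B} → ∣ A ∣ ≡ k → ∣ B ∣ ≡ k → Empty (A ∩ B) → f A ≢ f B
  distinct {A} {B} a b d e = proper (A , a) (B , b) d
    (trans (sym (extend-≡ c a)) (trans (sym (positive A a))
      (trans (cong suc e) (trans (positive B b) (extend-≡ c b)))))

-- Halving puts the colours 2i and 2i + 1 in class i. Colours up to `t` give classes 0 to `t / 2`,
-- hence the `suc`. Within a class the parity determines the colour, so properness makes parity a
-- valid mark.
star-free-bound : ∀ n k t → 2 ≤ k →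
  (c : KVertex n k → ℕ) → StarFree c → ColorsIn t c → n ≤ 2 * k + suc (t / 2)
star-free-bound n k t 2≤k c (proper , star-free) range =
  Labelling.bound k (2 * k) (suc (t / 2)) (λ A → extend c A / 2) (odd ∘ extend c)
    (m≤n+m (2 * k) 2) half<
    (λ a b d e o → differ a b d (half-odd-injective _ _ e o))
    matching (inj₂ (2≤k , ≤-refl))
  where
  half< : ∀ A → ∣ A ∣ ≡ k → extend c A / 2 < suc (t / 2)
  half< A a = s≤s (/-monoˡ-≤ 2 (subst (_≤ t) (sym (extend-≡ c a)) (proj₂ (range (A , a)))))
  differ : ∀ {A B} → ∣ A ∣ ≡ k → ∣ B ∣ ≡ k → Empty (A ∩ B) → extend c A ≢ extend c B
  differ {A} {B} a b d e = proper (A , a) (B , b) d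
    (trans (sym (extend-≡ c a)) (trans e (extend-≡ c b)))
  matching : ∀ {A A′ B} → ∣ A ∣ ≡ k → ∣ A′ ∣ ≡ k → ∣ B ∣ ≡ k →
    Empty (A ∩ B) → Empty (A′ ∩ B) →
    extend c A / 2 ≡ extend c B / 2 → extend c A′ / 2 ≡ extend c B / 2 → A ≡ A′
  matching {A} {A′} {B} a a′ b d d′ e e′ with Vec.≡-dec Bool._≟_ A A′
  ... | yes A≡A′ = A≡A′
  -- Otherwise `A`, `B`, `A′` is a path on three vertices whose colours lie in one pair of
  -- consecutive integers.
  ... | no  A≢A′ = contradiction (pair A a e , pair B b refl , pair A′ a′ e′)
    (star-free (A , a) (B , b) (A′ , a′) (extend c B / 2 * 2)
      ( (λ eq → disjoint-distinct 0<k a d (cong proj₁ eq))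
      , (λ eq → disjoint-distinct 0<k a′ d′ (sym (cong proj₁ eq)))
      , (λ eq → A≢A′ (cong proj₁ eq))
      , d , ∩-comm-Empty d′))
    where
    0<k = ≤-trans (s≤s z≤n) 2≤k
    pair : ∀ D {p} (eD : ∣ D ∣ ≡ k) → extend c D / 2 ≡ p → InPair (p * 2) (c (D , eD))
    pair D {p} eD e = subst (InPair (p * 2)) (extend-≡ c eD) (half-pair (extend c D) e)

theorem2 : ∀ (n k t : ℕ) → 4 ≤ 2 * k → 2 * k ≤ n →
    (c : KVertex n k → ℕ) → StarFree c → ColorsIn t c →
    (2 * χKG n k ∸ 10) ⊔ χKG n k ≤ t
theorem2 n k t 4≤2k 2k≤n c star-free range = ⊔-lub
  (begin
    -- The 3 is the 2 in `χKG` plus the one extra class. Doubling gives 2χ ≤ 6 + 2⌊t/2⌋, so even 2χ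
    -- - 6 is at most `t`.
    2 * χKG n k ∸ 10             ≤⟨ ∸-monoˡ-≤ 10 (*-monoʳ-≤ 2 χ≤) ⟩
    2 * (3 + t / 2) ∸ 10         ≡⟨ cong (_∸ 10) (*-distribˡ-+ 2 3 (t / 2)) ⟩
    6 + 2 * (t / 2) ∸ 10         ≡⟨ [m+n]∸[m+o]≡n∸o 6 (2 * (t / 2)) 4 ⟩
    2 * (t / 2) ∸ 4              ≤⟨ m∸n≤m (2 * (t / 2)) 4 ⟩
    2 * (t / 2)                  ≡⟨ *-comm 2 (t / 2) ⟩
    t / 2 * 2                    ≤⟨ m/n*n≤m t 2 ⟩
    t                            ∎)
  (m≤n+o⇒m∸n≤o (n + 2) (2 * k) (chromatic-bound n k t (≤-trans (s≤s (s≤s z≤n)) 4≤2k) c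
    (proj₁ star-free) range))
  where
  open ≤-Reasoning
  χ≤ : χKG n k ≤ 3 + t / 2
  χ≤ = m≤n+o⇒m∸n≤o (n + 2) (2 * k) (begin
    n + 2                         ≤⟨ +-monoˡ-≤ 2 (star-free-bound n k t
                                       (*-cancelˡ-≤ 2 4≤2k) c star-free range) ⟩
    2 * k + suc (t / 2) + 2       ≡⟨ +-assoc (2 * k) (suc (t / 2)) 2 ⟩
    2 * k + (suc (t / 2) + 2)     ≡⟨ cong (2 * k +_) (+-comm (suc (t / 2)) 2) ⟩
    2 * k + (3 + t / 2)           ∎)
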